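{- Let $a_1,\dots,a_n\in\mathbb{R}^d$ be the rows of $A$, let $k\ge1$ and $0<\epsilon<1$. Let $P$ be an $r$-dimensional linear subspace of $\mathbb{R}^d$ such that for all linear subspaces $W$ of dimension at most $k$, $$\sum_i\mathrm{dist}(a_i,P)-\sum_i\mathrm{dist}(a_i,P+W)\le\frac{\epsilon^2}{80}\mathrm{SubApx}_{k,1}(A).$$ Let $B\in\mathbb{R}^{d\times r}$ be an orthonormal basis for $P$ and set $\epsilon_c=\epsilon^2/6$. For each $i$ let $a_i^B\in\mathbb{R}^r$ satisfy $\mathrm{dist}(a_i,Ba_i^B)\le(1+\epsilon_c)\mathrm{dist}(a_i,P)$ and let $\mathrm{apx}_i$ satisfy $(1-\epsilon_c)\mathrm{dist}(a_i,P)\le\mathrm{apx}_i\le(1+\epsilon_c)\mathrm{dist}(a_i,P)$. Then for every shape $S$ lying in a $k$-dimensional subspace, $$\sum_i\sqrt{\mathrm{dist}(Ba_i^B,S)^2+\mathrm{apx}_i^2}=(1\pm5\epsilon)\sum_i\mathrm{dist}(a_i,S).$$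
   Context: $\mathrm{dist}(x,S)=\inf_{s\in S}\|x-s\|_2$. $\mathrm{SubApx}_{k,1}(A)=\min\{\sum_{i=1}^n\mathrm{dist}(a_i,Q): Q\text{ a linear subspace of }\mathbb{R}^d,\ \dim Q\le k\}$. $P+W$ is the span of $P\cup W$. A "shape lying in a $k$-dimensional subspace" is any nonempty set $S\subseteq\mathbb{R}^d$ contained in a linear subspace of dimension at most $k$. $x=(1\pm\epsilon)y$ means $(1-\epsilon)y\le x\le(1+\epsilon)y$. -}

module Defs where

open import Algebra.Bundles using (CommutativeRing)
import Algebra.Definitions as AlgebraDefinitions
import Algebra.Definitions.RawMonoid as RawMonoidDefinitions
import Algebra.Properties.Monoid.Sum as MonoidSum
import Algebra.Properties.Ring as RingProperties
import Algebra.Solver.Ring.NaturalCoefficients.Default as NatSolver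
open import Data.Fin.Base using (Fin; zero; suc)
open import Data.Nat.Base as ℕ using (ℕ; zero; suc; NonZero)
open import Data.Product.Base using (_×_; _,_; ∃; ∃-syntax; Σ-syntax; proj₁; proj₂)
open import Data.Sum.Base using (inj₁; inj₂)
open import Data.Vec.Functional using (Vector; map; zipWith; replicate; transpose)
import Data.Vec.Functional.Relation.Binary.Equality.Setoid as VectorEquality
open import Function.Base using (_∘_)
open import Agda.Primitive using (Setω)
open import Level using (0ℓ) renaming (suc to lsuc)
open import Relation.Binary.Core using (Rel)
import Relation.Binary.Construct.NonStrictToStrict as ToStrict
open import Relation.Binary.PropositionalEquality.Core using (_≢_)
open import Relation.Binary.Structures using (IsDecTotalOrder)
open import Relation.Nullary using (¬_; yes; no; contradiction)
open import Relation.Unary using (Pred; _∈_; _⊆_; _∪_; Satisfiable)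

module Bounds {A : Set} (_≤_ : Rel A 0ℓ) where

  UpperBound LowerBound IsSupremum IsInfimum IsMinimum : ∀ {ℓ} → Pred A ℓ → Pred A ℓ
  UpperBound E u = ∀ {x} → x ∈ E → x ≤ u
  LowerBound E l = ∀ {x} → x ∈ E → l ≤ x
  IsSupremum E s = UpperBound E s × (∀ {u} → UpperBound E u → s ≤ u)
  IsInfimum  E i = LowerBound E i × (∀ {l} → LowerBound E l → l ≤ i)
  IsMinimum  E m = m ∈ E × LowerBound E m

-- The real numbers, given by the axioms of a (Dedekind-)complete ordered
-- field, which determine them up to a unique isomorphism.  They are meant as
-- the reals of classical mathematics: the order is total and decidable, and
-- every inhabited set that is bounded above has a supremum.  "Set" means a
-- predicate in any universe, so that one may also take bounds over a family
-- indexed by all linear subspaces; this puts the record in Setω.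
record Reals : Setω where
  infix 4 _≤_
  field
    commutativeRing : CommutativeRing 0ℓ 0ℓ
  open CommutativeRing commutativeRing public renaming (Carrier to ℝ; zero to *-zero)
  field
    _≤_             : Rel ℝ 0ℓ
    isDecTotalOrder : IsDecTotalOrder _≈_ _≤_
  open Bounds _≤_ public
  open AlgebraDefinitions _≈_ public using (Invertible)
  field
    1≉0        : ¬ 1# ≈ 0#
    invertible : ∀ {x} → ¬ x ≈ 0# → Invertible 1# _*_ x
    +-monoˡ-≤  : ∀ z {x y} → x ≤ y → x + z ≤ y + z
    *-nonneg   : ∀ {x y} → 0# ≤ x → 0# ≤ y → 0# ≤ x * y
    supremum   : ∀ {ℓ} (E : Pred ℝ ℓ) → Satisfiable E → ∃ (UpperBound E) →
                 ∃ (IsSupremum E)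

module RealArithmetic (R : Reals) where
  open Reals R public
  open IsDecTotalOrder isDecTotalOrder public
    using (_≤?_; _≟_; total; antisym)
    renaming (refl to ≤-refl; trans to ≤-trans; reflexive to ≤-reflexive)
  open ToStrict _≈_ _≤_ public using (_<_)
  open MonoidSum +-monoid public using (sum; sum-syntax)
  open RawMonoidDefinitions +-rawMonoid public using () renaming (_×_ to _•_)
  open RingProperties ring using (-‿involutive; -‿distribˡ-*; -‿distribʳ-*)

  private
    module Solver = NatSolver commutativeSemiring

  infixl 7 _/_

  ≤-respˡ : ∀ {x x′ y} → x ≈ x′ → x ≤ y → x′ ≤ y
  ≤-respˡ x≈x′ = ≤-trans (≤-reflexive (sym x≈x′))

  ≤-respʳ : ∀ {x y y′} → y ≈ y′ → x ≤ y → x ≤ y′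
  ≤-respʳ y≈y′ x≤y = ≤-trans x≤y (≤-reflexive y≈y′)

  +-mono-≤ : ∀ {x y u v} → x ≤ y → u ≤ v → x + u ≤ y + v
  +-mono-≤ {x} {y} {u} {v} x≤y u≤v = ≤-trans (+-monoˡ-≤ u x≤y)
    (≤-respˡ (+-comm u y) (≤-respʳ (+-comm v y) (+-monoˡ-≤ y u≤v)))

  +-nonneg : ∀ {x y} → 0# ≤ x → 0# ≤ y → 0# ≤ x + y
  +-nonneg p q = ≤-respˡ (+-identityˡ 0#) (+-mono-≤ p q)

  x≤x+y : ∀ {x y} → 0# ≤ y → x ≤ x + y
  x≤x+y {x} 0≤y = ≤-respˡ (+-identityʳ x) (+-mono-≤ ≤-refl 0≤y)

  +-cancelʳ-≤ : ∀ z {x y} → x + z ≤ y + z → x ≤ y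
  +-cancelʳ-≤ z {x} {y} p = ≤-respˡ (lem x) (≤-respʳ (lem y) (+-monoˡ-≤ (- z) p))
    where
    lem : ∀ w → w + z + - z ≈ w
    lem w = trans (+-assoc w z (- z)) (trans (+-congˡ (-‿inverseʳ z)) (+-identityʳ w))

  ≤⇒∃+ : ∀ {x y} → x ≤ y → ∃[ δ ] 0# ≤ δ × y ≈ x + δ
  ≤⇒∃+ {x} {y} x≤y = y - x
    , ≤-respˡ (-‿inverseʳ x) (+-monoˡ-≤ (- x) x≤y)
    , sym (trans (+-comm x (y - x))
            (trans (+-assoc y (- x) x) (trans (+-congˡ (-‿inverseˡ x)) (+-identityʳ y))))

  ≰⇒≥ : ∀ {x y} → ¬ x ≤ y → y ≤ x
  ≰⇒≥ {x} {y} x≰y with total x y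
  ... | inj₁ x≤y = contradiction x≤y x≰y
  ... | inj₂ y≤x = y≤x

  *-monoˡ-≤ : ∀ {z x y} → 0# ≤ z → x ≤ y → z * x ≤ z * y
  *-monoˡ-≤ {z} {x} 0≤z x≤y with ≤⇒∃+ x≤y
  ... | δ , 0≤δ , y≈x+δ =
    ≤-respʳ (trans (sym (distribˡ z x δ)) (*-congˡ (sym y≈x+δ))) (x≤x+y (*-nonneg 0≤z 0≤δ))

  *-mono-≤ : ∀ {x y u v} → 0# ≤ x → 0# ≤ v → x ≤ y → u ≤ v → x * u ≤ y * v
  *-mono-≤ {x} {y} {u} {v} 0≤x 0≤v x≤y u≤v = ≤-trans (*-monoˡ-≤ 0≤x u≤v)
    (≤-respˡ (*-comm v x) (≤-respʳ (*-comm v y) (*-monoˡ-≤ 0≤v x≤y)))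

  square-nonneg : ∀ x → 0# ≤ x * x
  square-nonneg x with total 0# x
  ... | inj₁ 0≤x = *-nonneg 0≤x 0≤x
  ... | inj₂ x≤0 = ≤-respʳ -x*-x≈x*x (*-nonneg 0≤-x 0≤-x)
    where
    0≤-x : 0# ≤ - x
    0≤-x = ≤-respˡ (-‿inverseʳ x) (≤-respʳ (+-identityˡ (- x)) (+-monoˡ-≤ (- x) x≤0))
    -x*-x≈x*x : - x * - x ≈ x * x
    -x*-x≈x*x = trans (sym (-‿distribˡ-* x (- x)))
      (trans (-‿cong (sym (-‿distribʳ-* x x))) (-‿involutive (x * x)))

  0≤1 : 0# ≤ 1#
  0≤1 = ≤-respʳ (*-identityˡ 1#) (square-nonneg 1#)

  sum-nonneg : ∀ {n} (v : Vector ℝ n) → (∀ i → 0# ≤ v i) → 0# ≤ sum v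
  sum-nonneg {zero}  v 0≤v = ≤-refl
  sum-nonneg {suc n} v 0≤v = +-nonneg (0≤v zero) (sum-nonneg (v ∘ suc) (0≤v ∘ suc))

  •1-nonneg : ∀ n → 0# ≤ n • 1#
  •1-nonneg zero    = ≤-refl
  •1-nonneg (suc n) = +-nonneg 0≤1 (•1-nonneg n)

  1+nonneg≉0 : ∀ {x} → 0# ≤ x → ¬ 1# + x ≈ 0#
  1+nonneg≉0 0≤x eq = 1≉0 (antisym (≤-respʳ eq (x≤x+y 0≤x)) 0≤1)

  •1-nonzero : ∀ n .{{_ : NonZero n}} → ¬ n • 1# ≈ 0#
  •1-nonzero (suc n) = 1+nonneg≉0 (•1-nonneg n)

  _/_ : ℝ → (n : ℕ) .{{_ : NonZero n}} → ℝ
  x / n = x * proj₁ (invertible (•1-nonzero n))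

  abstract
    infimum : ∀ {ℓ} (E : Pred ℝ ℓ) → Satisfiable E → ∃ (LowerBound E) → ∃ (IsInfimum E)
    infimum E (e , e∈E) (b , b-lower)
      with supremum (LowerBound E) (b , b-lower) (e , λ l-lower → l-lower e∈E)
    ... | i , i-upper , i-least = i , (λ x∈E → i-least λ l-lower → l-lower x∈E) , i-upper

  infimum-unique : ∀ {ℓ} (E : Pred ℝ ℓ) {i j} → IsInfimum E i → IsInfimum E j → i ≈ j
  infimum-unique E (i-lower , i-greatest) (j-lower , j-greatest) =
    antisym (j-greatest i-lower) (i-greatest j-lower)

  minimum⇒infimum : ∀ {ℓ} (E : Pred ℝ ℓ) {m} → IsMinimum E m → IsInfimum E m
  minimum⇒infimum E (m∈E , m-lower) = m-lower , λ l-lower → l-lower m∈E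

  private
    *-1+ : ∀ a b → a * (1# + b) ≈ a + a * b
    *-1+ a b = trans (distribˡ a 1# b) (+-congʳ (*-identityʳ a))

    quotient : ∀ {D y} → 0# ≤ D → 0# ≤ y → ∃[ δ ] 0# ≤ δ × δ * (1# + y) ≈ D
    quotient {D} {y} 0≤D 0≤y with invertible (1+nonneg≉0 0≤y)
    ... | u , uM≈1 , _ = D * u , *-nonneg 0≤D 0≤u
      , trans (*-assoc D u M) (trans (*-congˡ uM≈1) (*-identityʳ D))
      where
      open Solver
      M = 1# + y
      0≤u : 0# ≤ u
      0≤u = ≤-respʳ (trans (*-congˡ uM≈1) (*-identityʳ u))
              (≤-respʳ (solve 2 (λ u M → M :* (u :* u) := u :* (u :* M)) refl u M)
                (*-nonneg (+-nonneg 0≤1 0≤y) (square-nonneg u)))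

    square-cancel-≤ : ∀ {x y} → 0# ≤ y → x * x ≤ y * y → x ≤ y
    square-cancel-≤ {x} {y} 0≤y x²≤y² with x ≤? y
    ... | yes x≤y = x≤y
    ... | no  x≰y with ≤⇒∃+ (≰⇒≥ x≰y)
    ...   | δ , 0≤δ , x≈y+δ = contradiction (≤-reflexive x≈y) x≰y
      where
      open Solver
      expand : x * x ≈ δ * δ + (y * δ + y * δ) + y * y
      expand = trans (*-cong x≈y+δ x≈y+δ)
        (solve 2 (λ y δ → (y :+ δ) :* (y :+ δ) := δ :* δ :+ (y :* δ :+ y :* δ) :+ y :* y) refl y δ)
      yδ : 0# ≤ y * δ + y * δ
      yδ = +-nonneg (*-nonneg 0≤y 0≤δ) (*-nonneg 0≤y 0≤δ)
      δ²≤0 : δ * δ ≤ 0#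
      δ²≤0 = ≤-trans (x≤x+y yδ) (+-cancelʳ-≤ (y * y)
        (≤-respˡ expand (≤-respʳ (sym (+-identityˡ (y * y))) x²≤y²)))
      δ≈0 : δ ≈ 0#
      δ≈0 with δ ≟ 0#
      ... | yes δ≈0 = δ≈0
      ... | no  δ≉0 with invertible δ≉0
      ...   | u , uδ≈1 , _ = trans (sym (*-identityˡ δ)) (trans (*-congʳ (sym uδ≈1))
                (trans (*-assoc u δ δ) (trans (*-congˡ (antisym δ²≤0 (square-nonneg δ))) (zeroʳ u))))
      x≈y : x ≈ y
      x≈y = trans x≈y+δ (trans (+-congˡ δ≈0) (+-identityʳ y))

    vanish : ∀ {w y D δ M} → y ≈ w + D → δ * M ≈ D → δ ≈ 0# → y ≈ w
    vanish {w} {M = M} y≈w+D δM≈D δ≈0 = trans y≈w+D (trans (+-congˡ D≈0) (+-identityʳ w))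
      where
      D≈0 = trans (sym δM≈D) (trans (*-congʳ δ≈0) (zeroˡ M))

    step-up : ∀ {s δ D x} → 0# ≤ s → 0# ≤ δ → 0# ≤ D →
              δ * (1# + (s + s + D)) ≈ D → x ≈ s * s + D → (s + δ) * (s + δ) ≤ x
    step-up {s} {δ} {D} {x} 0≤s 0≤δ 0≤D δM≈D x≈s²+D =
      ≤-respˡ lhs (≤-respʳ rhs (+-mono-≤ (*-monoˡ-≤ 0≤δ δ≤1+D) ≤-refl))
      where
      open Solver
      N = s + s + D
      δ≤1+D : δ ≤ 1# + D
      δ≤1+D = ≤-trans (x≤x+y (*-nonneg 0≤δ (+-nonneg (+-nonneg 0≤s 0≤s) 0≤D)))
        (≤-respˡ (trans (sym δM≈D) (*-1+ δ N)) (≤-respʳ (+-comm D 1#) (x≤x+y 0≤1)))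
      rest = s * s + (s + s) * δ
      lhs : δ * δ + rest ≈ (s + δ) * (s + δ)
      lhs = solve 2 (λ s δ → δ :* δ :+ (s :* s :+ (s :+ s) :* δ) := (s :+ δ) :* (s :+ δ)) refl s δ
      rhs : δ * (1# + D) + rest ≈ x
      rhs = trans (+-congʳ (*-1+ δ D))
        (trans (solve 3 (λ s δ D → δ :+ δ :* D :+ (s :* s :+ (s :+ s) :* δ)
                                   := s :* s :+ (δ :+ δ :* (s :+ s :+ D))) refl s δ D)
          (trans (+-congˡ (trans (sym (*-1+ δ N)) δM≈D)) (sym x≈s²+D)))

    step-small : ∀ {s δ D x} → 0# ≤ x → 0# ≤ s → 0# ≤ δ →
                 δ * (1# + (s + s)) ≈ D → s * s ≈ x + D → δ ≤ s
    step-small {s} {δ} {D} {x} 0≤x 0≤s 0≤δ δM≈D s²≈x+D with total δ s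
    ... | inj₁ δ≤s = δ≤s
    ... | inj₂ s≤δ = ≤-trans (x≤x+y (*-nonneg 0≤s 0≤δ)) (≤-trans δ+sδ≤0 0≤s)
      where
      open Solver
      D≈ : D ≈ δ + s * δ + s * δ
      D≈ = trans (sym δM≈D) (trans (*-1+ δ (s + s))
        (solve 2 (λ s δ → δ :+ δ :* (s :+ s) := δ :+ s :* δ :+ s :* δ) refl s δ))
      D≤s² : D ≤ s * s
      D≤s² = ≤-respʳ (trans (+-comm D x) (sym s²≈x+D)) (x≤x+y 0≤x)
      δ+sδ≤0 : δ + s * δ ≤ 0#
      δ+sδ≤0 = +-cancelʳ-≤ (s * δ) (≤-respˡ D≈
        (≤-respʳ (sym (+-identityˡ (s * δ))) (≤-trans D≤s² (*-monoˡ-≤ 0≤s s≤δ))))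

    step-down : ∀ {s δ r D x} → 0# ≤ δ → δ * (1# + (s + s)) ≈ D →
                s * s ≈ x + D → s ≈ δ + r → x ≤ r * r
    step-down {s} {δ} {r} {D} {x} 0≤δ δM≈D s²≈x+D s≈δ+r =
      ≤-trans (x≤x+y (+-nonneg 0≤δ (square-nonneg δ))) (+-cancelʳ-≤ Z (≤-reflexive expand))
      where
      open Solver
      Z = (r + r) * δ + δ * δ
      D≈ : δ + δ * ((δ + r) + (δ + r)) ≈ D
      D≈ = trans (+-congˡ (*-congˡ (+-cong (sym s≈δ+r) (sym s≈δ+r))))
        (trans (sym (*-1+ δ (s + s))) δM≈D)
      expand : (x + (δ + δ * δ)) + Z ≈ r * r + Z
      expand = trans
        (solve 3 (λ x δ r → x :+ (δ :+ δ :* δ) :+ ((r :+ r) :* δ :+ δ :* δ)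
                            := x :+ (δ :+ δ :* ((δ :+ r) :+ (δ :+ r)))) refl x δ r)
        (trans (+-congˡ D≈) (trans (sym s²≈x+D) (trans (*-cong s≈δ+r s≈δ+r)
          (solve 2 (λ δ r → (δ :+ r) :* (δ :+ r) := r :* r :+ ((r :+ r) :* δ :+ δ :* δ)) refl δ r))))

    no-step : ∀ {w δ} → 0# ≤ δ → w + δ ≤ w → δ ≈ 0#
    no-step {w} {δ} 0≤δ w+δ≤w = antisym
      (+-cancelʳ-≤ w (≤-respˡ (+-comm w δ) (≤-respʳ (sym (+-identityˡ w)) w+δ≤w))) 0≤δ

    supremum-square : ∀ {x s} → 0# ≤ x → IsSupremum (λ t → t * t ≤ x) s → 0# ≤ s × s * s ≈ x
    supremum-square {x} {s} 0≤x (upper , least) = 0≤s , s²≈x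
      where
      0≤s : 0# ≤ s
      0≤s = upper (≤-respˡ (sym (zeroˡ 0#)) 0≤x)
      not-below : ∃[ D ] 0# ≤ D × x ≈ s * s + D → s * s ≈ x
      not-below (D , 0≤D , x≈s²+D) = go (quotient 0≤D (+-nonneg (+-nonneg 0≤s 0≤s) 0≤D))
        where
        go : ∃[ δ ] 0# ≤ δ × δ * (1# + (s + s + D)) ≈ D → s * s ≈ x
        go (δ , 0≤δ , δM≈D) = sym (vanish x≈s²+D δM≈D
          (no-step 0≤δ (upper (step-up 0≤s 0≤δ 0≤D δM≈D x≈s²+D))))
      not-above : ∃[ D ] 0# ≤ D × s * s ≈ x + D → s * s ≈ x
      not-above (D , 0≤D , s²≈x+D) = go (quotient 0≤D (+-nonneg 0≤s 0≤s))
        where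
        go : ∃[ δ ] 0# ≤ δ × δ * (1# + (s + s)) ≈ D → s * s ≈ x
        go (δ , 0≤δ , δM≈D) = vanish s²≈x+D δM≈D
          (finish (≤⇒∃+ (step-small 0≤x 0≤s 0≤δ δM≈D s²≈x+D)))
          where
          finish : ∃[ r ] 0# ≤ r × s ≈ δ + r → δ ≈ 0#
          finish (r , 0≤r , s≈δ+r) = no-step 0≤δ (≤-respˡ (trans s≈δ+r (+-comm δ r))
            (least λ t²≤x →
              square-cancel-≤ 0≤r (≤-trans t²≤x (step-down 0≤δ δM≈D s²≈x+D s≈δ+r))))
      s²≈x : s * s ≈ x
      s²≈x with total (s * s) x
      ... | inj₁ s²≤x = not-below (≤⇒∃+ s²≤x)
      ... | inj₂ x≤s² = not-above (≤⇒∃+ x≤s²)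

  abstract
    sqrt-exists : ∀ {x} → 0# ≤ x → ∃[ s ] 0# ≤ s × s * s ≈ x
    sqrt-exists {x} 0≤x = proj₁ sup , supremum-square 0≤x (proj₂ sup)
      where
      0≤1+x : 0# ≤ 1# + x
      0≤1+x = +-nonneg 0≤1 0≤x
      bound : UpperBound (λ t → t * t ≤ x) (1# + x)
      bound t²≤x = square-cancel-≤ 0≤1+x (≤-trans t²≤x
        (≤-trans (≤-respʳ (+-comm x 1#) (x≤x+y 0≤1))
          (≤-respˡ (*-identityˡ (1# + x)) (*-mono-≤ 0≤1 0≤1+x (x≤x+y 0≤x) ≤-refl))))
      sup : ∃ (IsSupremum (λ t → t * t ≤ x))
      sup = supremum (λ t → t * t ≤ x) (0# , ≤-respˡ (sym (zeroˡ 0#)) 0≤x)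
              (1# + x , λ {t} → bound {t})

  -- √ x is 0# for negative x.
  √ : ℝ → ℝ
  √ x with 0# ≤? x
  ... | yes 0≤x = proj₁ (sqrt-exists 0≤x)
  ... | no  _   = 0#

  √-nonneg : ∀ x → 0# ≤ √ x
  √-nonneg x with 0# ≤? x
  ... | yes 0≤x = proj₁ (proj₂ (sqrt-exists 0≤x))
  ... | no  _   = ≤-refl

  √-square : ∀ {x} → 0# ≤ x → √ x * √ x ≈ x
  √-square {x} 0≤x with 0# ≤? x
  ... | yes 0≤x = proj₂ (proj₂ (sqrt-exists 0≤x))
  ... | no  0≰x = contradiction 0≤x 0≰x

  -- x = (1 ± η) y
  infix 4 _≈⟨1±_⟩_
  _≈⟨1±_⟩_ : ℝ → ℝ → ℝ → Set
  x ≈⟨1± η ⟩ y = (1# - η) * y ≤ x × x ≤ (1# + η) * y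

module EuclideanSpace (R : Reals) where
  open RealArithmetic R public
  open VectorEquality setoid public using (_≋_)

  infixl 6 _+ᵛ_ _-ᵛ_ _⊞_
  infixr 7 _*ᵛ_ _·_

  Point : ℕ → Set
  Point = Vector ℝ

  Matrix : ℕ → ℕ → Set
  Matrix m n = Vector (Vector ℝ n) m

  0ᵛ : ∀ {d} → Point d
  0ᵛ = replicate _ 0#

  _+ᵛ_ _-ᵛ_ : ∀ {d} → Point d → Point d → Point d
  _+ᵛ_ = zipWith _+_
  _-ᵛ_ = zipWith _-_

  _*ᵛ_ : ∀ {d} → ℝ → Point d → Point d
  c *ᵛ x = map (c *_) x

  ⟪_,_⟫ : ∀ {d} → Point d → Point d → ℝ
  ⟪ x , y ⟫ = sum (zipWith _*_ x y)

  ‖_‖ : ∀ {d} → Point d → ℝ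
  ‖ x ‖ = √ ⟪ x , x ⟫

  _·_ : ∀ {m n} → Matrix m n → Point n → Point m
  (M · x) i = ⟪ M i , x ⟫

  combination : ∀ {m d} → Vector ℝ m → Vector (Point d) m → Point d
  combination {m} c v j = ∑[ i < m ] (c i * v i j)

  LinearlyIndependent : ∀ {m d} → Vector (Point d) m → Set
  LinearlyIndependent v = ∀ c → combination c v ≋ 0ᵛ → c ≋ 0ᵛ

  Orthonormal : ∀ {m d} → Vector (Point d) m → Set
  Orthonormal v = (∀ i → ⟪ v i , v i ⟫ ≈ 1#) × (∀ i j → i ≢ j → ⟪ v i , v j ⟫ ≈ 0#)

  span : ∀ {d} → Pred (Point d) 0ℓ → Pred (Point d) 0ℓ
  span X x = ∃[ m ] Σ[ c ∈ Vector ℝ m ] Σ[ v ∈ Vector (Point _) m ]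
    (∀ i → v i ∈ X) × x ≋ combination c v

  record Subspace (d : ℕ) : Set₁ where
    field
      points : Pred (Point d) 0ℓ
      resp   : ∀ {x y} → x ≋ y → x ∈ points → y ∈ points
      0∈     : 0ᵛ ∈ points
      +∈     : ∀ {x y} → x ∈ points → y ∈ points → x +ᵛ y ∈ points
      *∈     : ∀ c {x} → x ∈ points → c *ᵛ x ∈ points

  IsBasis : ∀ {m d} → Subspace d → Vector (Point d) m → Set
  IsBasis V v = (∀ i → v i ∈ points) × LinearlyIndependent v
              × (∀ {x} → x ∈ points → ∃[ c ] x ≋ combination c v)
    where open Subspace V

  HasDimension : ∀ {d} → Subspace d → ℕ → Set
  HasDimension V m = ∃[ v ] IsBasis {m} V v

  HasDimension≤ : ∀ {d} → Subspace d → ℕ → Set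
  HasDimension≤ V k = ∃[ m ] m ℕ.≤ k × HasDimension V m

  IsOrthonormalBasis : ∀ {d r} → Subspace d → Matrix d r → Set
  IsOrthonormalBasis P B = IsBasis P (transpose B) × Orthonormal (transpose B)

  record NonemptySet (d : ℕ) : Set₁ where
    field
      points   : Pred (Point d) 0ℓ
      nonempty : Satisfiable points

  ⌊_⌋ : ∀ {d} → Subspace d → NonemptySet d
  ⌊ V ⌋ = record { points = points ; nonempty = 0ᵛ , 0∈ }
    where open Subspace V

  -- The subspace P + W, as a set of points
  _⊞_ : ∀ {d} → Subspace d → Subspace d → NonemptySet d
  P ⊞ W = record
    { points   = span (Subspace.points P ∪ Subspace.points W)
    ; nonempty = 0ᵛ , 0 , (λ ()) , (λ ()) , (λ ()) , λ _ → refl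
    }

  LiesIn : ∀ {d} → NonemptySet d → Subspace d → Set
  LiesIn S V = NonemptySet.points S ⊆ Subspace.points V

  distances : ∀ {d} → Point d → NonemptySet d → Pred ℝ 0ℓ
  distances x S t = ∃[ s ] s ∈ NonemptySet.points S × t ≈ ‖ x -ᵛ s ‖

  distances-nonneg : ∀ {d} (x : Point d) S → LowerBound (distances x S) 0#
  distances-nonneg x S (s , _ , t≈) = ≤-respʳ (sym t≈) (√-nonneg _)

  dist-exists : ∀ {d} (x : Point d) (S : NonemptySet d) → ∃ (IsInfimum (distances x S))
  dist-exists x S with NonemptySet.nonempty S
  ... | s , s∈S = infimum (distances x S) (‖ x -ᵛ s ‖ , s , s∈S , refl)
                    (0# , λ {t} → distances-nonneg x S {t})

  dist : ∀ {d} → Point d → NonemptySet d → ℝ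
  dist x S = proj₁ (dist-exists x S)

  dist-nonneg : ∀ {d} (x : Point d) S → 0# ≤ dist x S
  dist-nonneg x S = proj₂ (proj₂ (dist-exists x S)) λ {t} → distances-nonneg x S {t}

  ∑dist : ∀ {n d} → Matrix n d → NonemptySet d → ℝ
  ∑dist {n} A S = ∑[ i < n ] dist (A i) S

  zero-subspace : ∀ {d} → Subspace d
  zero-subspace = record
    { points = _≋ 0ᵛ
    ; resp   = λ x≋y x≋0 i → trans (sym (x≋y i)) (x≋0 i)
    ; 0∈     = λ _ → refl
    ; +∈     = λ x≋0 y≋0 i → trans (+-cong (x≋0 i) (y≋0 i)) (+-identityˡ 0#)
    ; *∈     = λ c x≋0 i → trans (*-congˡ (x≋0 i)) (zeroʳ c)
    }

  zero-subspace-dim : ∀ {d} k → HasDimension≤ (zero-subspace {d}) k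
  zero-subspace-dim k = 0 , ℕ.z≤n , (λ ()) , (λ ()) , (λ _ _ ()) , λ x≋0 → (λ ()) , x≋0

  module _ {n d : ℕ} (k : ℕ) (A : Matrix n d) where

    subspaceCosts : Pred ℝ (lsuc 0ℓ)
    subspaceCosts t = Σ[ Q ∈ Subspace d ] HasDimension≤ Q k × t ≈ ∑dist A ⌊ Q ⌋

    private
      costs-nonneg : LowerBound subspaceCosts 0#
      costs-nonneg (Q , _ , t≈) = ≤-respʳ (sym t≈)
        (sum-nonneg (λ i → dist (A i) ⌊ Q ⌋) λ i → dist-nonneg (A i) ⌊ Q ⌋)

    SubApx-exists : ∃ (IsInfimum subspaceCosts)
    SubApx-exists = infimum subspaceCosts
      (∑dist A ⌊ zero-subspace ⌋ , zero-subspace , zero-subspace-dim k , refl)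
      (0# , λ {t} → costs-nonneg {t})

    -- The minimum of the costs is taken as their infimum, so that it is defined
    -- without first proving attainment; SubApx-minimum shows the two agree.
    SubApx : ℝ
    SubApx = proj₁ SubApx-exists

    SubApx-minimum : ∀ {m} → IsMinimum subspaceCosts m → SubApx ≈ m
    SubApx-minimum m-min = infimum-unique subspaceCosts
      (proj₂ SubApx-exists) (minimum⇒infimum subspaceCosts m-min)

{-# OPTIONS --safe #-}
module Submission where

-- No orthogonal projection is needed.  Let b = B aᴮ ∈ P, d = dist a P,
-- e = dist a (P + V) and f² = ‖a - b‖² - e².  For s ∈ S ⊆ V and every real t the
-- point b - t (b - s) lies in P + V, so e² ≤ ‖(a - b) + t (b - s)‖²; the
-- discriminant of this quadratic in t gives ⟨a - b , b - s⟩² ≤ f² ‖b - s‖².  Hence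
--   (‖b - s‖ - f)² + e² ≤ ‖a - s‖² ≤ (‖b - s‖ + f)² + e²,
-- so dist a S and √((dist b S)² + apx²) differ by at most δ = f + (d - e) + ε-c d.
-- By AM-GM ε f ≤ (d - e) + 2 ε² d.  Summed over the rows, with T = ∑ dist a S,
-- ∑ (d - e) ≤ (ε² / 80) T because SubApx ≤ T, and ∑ d ≤ T + ∑ (d - e), which gives
-- ε ∑ δ ≤ 2 ∑ (d - e) + 3 ε² ∑ d ≤ 4 ε² T.

open import Defs
open import Data.Fin.Base using (Fin; zero; suc)
open import Data.Nat.Base as ℕ using (ℕ; zero; suc; NonZero)
import Data.Nat.Properties as ℕ
open import Data.Product.Base using (_×_; _,_; ∃-syntax; proj₁; proj₂)
open import Data.Sum.Base using (_⊎_; inj₁; inj₂)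
open import Data.Vec.Functional using (Vector; transpose)
open import Function.Base using (_∘_)
open import Level using (0ℓ)
open import Relation.Binary.Bundles using (Poset)
open import Relation.Binary.Structures using (IsDecTotalOrder)
open import Relation.Nullary using (¬_; yes; no; contradiction)
open import Relation.Unary using (_∈_; _⊆_; _∪_)
import Algebra.Properties.AbelianGroup as AbelianGroupProperties
import Algebra.Properties.CommutativeMonoid.Sum as CommutativeMonoidSum
import Algebra.Properties.Monoid.Mult as MonoidMult
import Algebra.Properties.Ring as RingProperties
import Algebra.Properties.Semiring.Mult as SemiringMult
import Algebra.Properties.Semiring.Sum as SemiringSum
import Algebra.Solver.Ring.NaturalCoefficients.Default as NatSolver
import Relation.Binary.Reasoning.PartialOrder as PosetReasoning

-- Order and cancellation laws in the real field.

module OrderedField (R : Reals) where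
  open RealArithmetic R
  open RingProperties ring using (-‿distribˡ-*; -‿distribʳ-*; -‿involutive)
  open CommutativeMonoidSum +-commutativeMonoid using (∑-distrib-+)
  open SemiringSum semiring using (*-distribˡ-sum)
  open MonoidMult +-monoid using (×-congʳ)
  open SemiringMult semiring using (×-comm-*; ×-assoc-*)
  open NatSolver commutativeSemiring using (solve; _:=_; _:+_; _:*_; con)

  ≤-poset : Poset 0ℓ 0ℓ 0ℓ
  ≤-poset = record { isPartialOrder = IsDecTotalOrder.isPartialOrder isDecTotalOrder }

  module ≤-Reasoning = PosetReasoning ≤-poset
  open ≤-Reasoning

  +-monoʳ-≤ : ∀ z {x y} → x ≤ y → z + x ≤ z + y
  +-monoʳ-≤ z = +-mono-≤ ≤-refl

  *-monoʳ-≤ : ∀ {z x y} → 0# ≤ z → x ≤ y → x * z ≤ y * z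
  *-monoʳ-≤ {z} {x} {y} 0≤z x≤y = begin
    x * z ≈⟨ *-comm x z ⟩
    z * x ≤⟨ *-monoˡ-≤ 0≤z x≤y ⟩
    z * y ≈⟨ *-comm z y ⟩
    y * z ∎

  *-cong-≤ : ∀ {x y} → 0# ≤ x → x ≤ y → x * x ≤ y * y
  *-cong-≤ 0≤x x≤y = *-mono-≤ 0≤x (≤-trans 0≤x x≤y) x≤y x≤y

  y≤x+y : ∀ {x y} → 0# ≤ x → y ≤ x + y
  y≤x+y {x} {y} 0≤x = ≤-respʳ (+-comm y x) (x≤x+y 0≤x)

  x-y+y≈x : ∀ x y → x - y + y ≈ x
  x-y+y≈x x y = trans (+-assoc x (- y) y) (trans (+-congˡ (-‿inverseˡ y)) (+-identityʳ x))

  x≤y+z⇒x-z≤y : ∀ {x y z} → x ≤ y + z → x - z ≤ y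
  x≤y+z⇒x-z≤y {x} {y} {z} x≤y+z = +-cancelʳ-≤ z (≤-respˡ (sym (x-y+y≈x x z)) x≤y+z)

  x-z≤y⇒x≤y+z : ∀ {x y z} → x - z ≤ y → x ≤ y + z
  x-z≤y⇒x≤y+z {x} {y} {z} p = ≤-respˡ (x-y+y≈x x z) (+-monoˡ-≤ z p)

  x≤y⇒0≤y-x : ∀ {x y} → x ≤ y → 0# ≤ y - x
  x≤y⇒0≤y-x {x} x≤y = ≤-respˡ (-‿inverseʳ x) (+-monoˡ-≤ (- x) x≤y)

  -x≤y⇒0≤x+y : ∀ {x y} → - x ≤ y → 0# ≤ x + y
  -x≤y⇒0≤x+y {x} -x≤y = ≤-respˡ (-‿inverseʳ x) (+-monoʳ-≤ x -x≤y)

  -x*-x≈x*x : ∀ x → - x * - x ≈ x * x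
  -x*-x≈x*x x = trans (sym (-‿distribˡ-* x (- x)))
    (trans (-‿cong (sym (-‿distribʳ-* x x))) (-‿involutive (x * x)))

  ≰⇒> : ∀ {x y} → ¬ x ≤ y → y < x
  ≰⇒> x≰y = ≰⇒≥ x≰y , λ y≈x → x≰y (≤-reflexive (sym y≈x))

  inverse-nonneg : ∀ {x u} → 0# ≤ x → u * x ≈ 1# → 0# ≤ u
  inverse-nonneg {x} {u} 0≤x ux≈1 = begin
    0#          ≤⟨ *-nonneg 0≤x (square-nonneg u) ⟩
    x * (u * u) ≈⟨ solve 2 (λ x u → x :* (u :* u) := u :* x :* u) refl x u ⟩
    u * x * u   ≈⟨ *-congʳ ux≈1 ⟩
    1# * u      ≈⟨ *-identityˡ u ⟩
    u           ∎

  *-cancelˡ-≤ : ∀ {z x y} → 0# < z → z * x ≤ z * y → x ≤ y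
  *-cancelˡ-≤ {z} {x} {y} (0≤z , 0≉z) zx≤zy with invertible (0≉z ∘ sym)
  ... | u , uz≈1 , _ = begin
    x           ≈⟨ u*zx≈x x ⟨
    u * (z * x) ≤⟨ *-monoˡ-≤ (inverse-nonneg 0≤z uz≈1) zx≤zy ⟩
    u * (z * y) ≈⟨ u*zx≈x y ⟩
    y           ∎
    where
    u*zx≈x : ∀ x → u * (z * x) ≈ x
    u*zx≈x x = trans (sym (*-assoc u z x)) (trans (*-congʳ uz≈1) (*-identityˡ x))

  -- If `x` is positive and `y ≤ x`, then `x * x ≤ y * y ≤ x * y`, and one factor `x` cancels.
  square-cancel-≤ : ∀ {x y} → 0# ≤ y → x * x ≤ y * y → x ≤ y
  square-cancel-≤ {x} {y} 0≤y x²≤y² with x ≤? 0# | total x y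
  ... | yes x≤0 | _        = ≤-trans x≤0 0≤y
  ... | no  _   | inj₁ x≤y = x≤y
  ... | no  x≰0 | inj₂ y≤x = *-cancelˡ-≤ (≰⇒> x≰0) (≤-trans x²≤y² (*-monoʳ-≤ 0≤y y≤x))

  √-upper : ∀ {x y} → 0# ≤ x → 0# ≤ y → y * y ≤ x → y ≤ √ x
  √-upper {x} 0≤x 0≤y y²≤x =
    square-cancel-≤ (√-nonneg x) (≤-respʳ (sym (√-square 0≤x)) y²≤x)

  -- For nonzero `β` the quadratic is evaluated at its minimiser `- θ` over `β` and multiplied by
  -- `β`, which completes the square. For `β ≈ 0` it is affine in `t`, and nonnegativity on the
  -- whole line forces `θ ≈ 0#`.
  discriminant : ∀ {α θ β} → 0# ≤ α → 0# ≤ β →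
                 (∀ t → 0# ≤ α + (t * θ + t * θ) + t * t * β) → θ * θ ≤ α * β
  discriminant {α} {θ} {β} 0≤α 0≤β q with β ≟ 0#
  ... | no β≉0 with invertible β≉0
  ...   | u , uβ≈1 , _ = begin
    θ * θ
      ≈⟨ +-identityˡ _ ⟨
    0# + θ * θ
      ≤⟨ +-monoˡ-≤ (θ * θ) (*-nonneg 0≤β (q (n * u))) ⟩
    β * (α + (n * u * θ + n * u * θ) + n * u * (n * u) * β) + θ * θ
      ≈⟨ solve 5 (λ α θ β n u → β :* (α :+ (n :* u :* θ :+ n :* u :* θ) :+ n :* u :* (n :* u) :* β) :+ θ :* θ
           := α :* β :+ ((n :* θ :+ n :* θ) :* (u :* β) :+ n :* n :* (u :* β :* (u :* β)) :+ θ :* θ))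
           refl α θ β n u ⟩
    α * β + ((n * θ + n * θ) * (u * β) + n * n * (u * β * (u * β)) + θ * θ)
      ≈⟨ +-congˡ (+-congʳ (+-cong (*-congˡ uβ≈1) (*-congˡ (*-cong uβ≈1 uβ≈1)))) ⟩
    α * β + ((n * θ + n * θ) * 1# + n * n * (1# * 1#) + θ * θ)
      ≈⟨ solve 4 (λ α θ β n → α :* β :+ ((n :* θ :+ n :* θ) :* con 1 :+ n :* n :* (con 1 :* con 1) :+ θ :* θ)
           := α :* β :+ (n :+ θ) :* (n :+ θ)) refl α θ β n ⟩
    α * β + (n + θ) * (n + θ)
      ≈⟨ +-congˡ (trans (*-congʳ (-‿inverseˡ θ)) (zeroˡ (n + θ))) ⟩
    α * β + 0#
      ≈⟨ +-identityʳ _ ⟩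
    α * β ∎
    where n = - θ
  discriminant {α} {θ} {β} 0≤α 0≤β q | yes β≈0 with θ ≟ 0#
  ... | yes θ≈0 = ≤-respˡ (sym (trans (*-congʳ θ≈0) (zeroˡ θ))) (*-nonneg 0≤α 0≤β)
  ... | no  θ≉0 with invertible θ≉0
  ...   | u , uθ≈1 , _ = contradiction (antisym 1≤0 0≤1) 1≉0
    where
    -- At `t = n * u` the affine expression equals `α + 2 n`, that is `- (α + 2)`, which is
    -- negative.
    n = - (α + 1#)
    1≤0 : 1# ≤ 0#
    1≤0 = +-cancelʳ-≤ α (≤-trans (x≤x+y 0≤1) (begin
      1# + α + 1#
        ≈⟨ +-identityˡ _ ⟨
      0# + (1# + α + 1#)
        ≤⟨ +-monoˡ-≤ _ (q (n * u)) ⟩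
      α + (n * u * θ + n * u * θ) + n * u * (n * u) * β + (1# + α + 1#)
        ≈⟨ +-congʳ (+-cong (+-congˡ (+-cong nuθ≈n nuθ≈n)) (trans (*-congˡ β≈0) (zeroʳ _))) ⟩
      α + (n + n) + 0# + (1# + α + 1#)
        ≈⟨ solve 2 (λ α n → α :+ (n :+ n) :+ con 0 :+ (con 1 :+ α :+ con 1)
             := n :+ (α :+ con 1) :+ (n :+ (α :+ con 1))) refl α n ⟩
      n + (α + 1#) + (n + (α + 1#))
        ≈⟨ +-cong (-‿inverseˡ _) (-‿inverseˡ _) ⟩
      0# + 0#
        ≤⟨ +-monoʳ-≤ 0# 0≤α ⟩
      0# + α ∎))
      where
      nuθ≈n : n * u * θ ≈ n
      nuθ≈n = trans (*-assoc n u θ) (trans (*-congˡ uθ≈1) (*-identityʳ n))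

  -- Natural multiples, division by naturals, finite sums.

  •-monoˡ-≤ : ∀ {m n x} → 0# ≤ x → m ℕ.≤ n → m • x ≤ n • x
  •-monoˡ-≤ {n = n} 0≤x ℕ.z≤n       = •-nonneg n
    where
    •-nonneg : ∀ n → 0# ≤ n • _
    •-nonneg zero    = ≤-refl
    •-nonneg (suc n) = +-nonneg 0≤x (•-nonneg n)
  •-monoˡ-≤         0≤x (ℕ.s≤s m≤n) = +-monoʳ-≤ _ (•-monoˡ-≤ 0≤x m≤n)

  /-nonneg : ∀ {x} n .{{_ : NonZero n}} → 0# ≤ x → 0# ≤ x / n
  /-nonneg n 0≤x = *-nonneg 0≤x
    (inverse-nonneg (•1-nonneg n) (proj₁ (proj₂ (invertible (•1-nonzero n)))))

  n•[x/n]≈x : ∀ x n .{{_ : NonZero n}} → n • (x / n) ≈ x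
  n•[x/n]≈x x n with invertible (•1-nonzero n)
  ... | u , _ , nu≈1 = begin-equality
    n • (x * u)        ≈⟨ ×-comm-* n x u ⟨
    x * (n • u)        ≈⟨ *-congˡ (trans (×-assoc-* n 1# u) (×-congʳ n (*-identityˡ u))) ⟨
    x * (n • 1# * u)   ≈⟨ *-congˡ nu≈1 ⟩
    x * 1#             ≈⟨ *-identityʳ x ⟩
    x                  ∎

  •-monoʳ-≤ : ∀ n {x y} → x ≤ y → n • x ≤ n • y
  •-monoʳ-≤ zero    x≤y = ≤-refl
  •-monoʳ-≤ (suc n) x≤y = +-mono-≤ x≤y (•-monoʳ-≤ n x≤y)

  -- Supplies what is used of the constants 6 and 80: `η / 6 ≤ η` and `5 • (η / 80) ≤ η` for
  -- `η = ε * ε`.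
  m•[x/n]≤x : ∀ {x} m n .{{_ : NonZero n}} → 0# ≤ x → m ℕ.≤ n → m • (x / n) ≤ x
  m•[x/n]≤x m n 0≤x m≤n =
    ≤-respʳ (n•[x/n]≈x _ n) (•-monoˡ-≤ (/-nonneg n 0≤x) m≤n)

  sum-mono-≤ : ∀ {n} {u v : Vector ℝ n} → (∀ i → u i ≤ v i) → sum u ≤ sum v
  sum-mono-≤ {zero}  u≤v = ≤-refl
  sum-mono-≤ {suc n} u≤v = +-mono-≤ (u≤v zero) (sum-mono-≤ (u≤v ∘ suc))

  -- The factor `ε` stays in place through the summation, because AM-GM controls `ε * f` and not `f`
  -- itself.
  ε*sum-mono-≤ : ∀ {n} ε (x y z : Vector ℝ n) → (∀ i → ε * x i ≤ ε * y i + z i) →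
                 ε * sum x ≤ ε * sum y + sum z
  ε*sum-mono-≤ ε x y z x≤y+z = begin
    ε * sum x                          ≈⟨ *-distribˡ-sum ε x ⟩
    sum (λ i → ε * x i)                ≤⟨ sum-mono-≤ x≤y+z ⟩
    sum (λ i → ε * y i + z i)          ≈⟨ ∑-distrib-+ (λ i → ε * y i) z ⟩
    sum (λ i → ε * y i) + sum z        ≈⟨ +-congʳ (*-distribˡ-sum ε y) ⟨
    ε * sum y + sum z                  ∎

  -- Real inequalities behind the comparison for one row.

  -- A form of the triangle inequality in the plane, with the shift `(h , k)` measured by `h + k`.
  -- Both `x` and `y` are at most `N`, which bounds the cross terms, and `h² + k² ≤ (h + k)²`.
  hypotenuse-mono : ∀ {x y N h k} → 0# ≤ x → 0# ≤ y → 0# ≤ N → 0# ≤ h → 0# ≤ k →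
                    x * x + y * y ≤ N * N →
                    (x + h) * (x + h) + (y + k) * (y + k) ≤ (N + (h + k)) * (N + (h + k))
  hypotenuse-mono {x} {y} {N} {h} {k} 0≤x 0≤y 0≤N 0≤h 0≤k x²+y²≤N² = begin
    (x + h) * (x + h) + (y + k) * (y + k)
      ≈⟨ solve 4 (λ x y h k → (x :+ h) :* (x :+ h) :+ (y :+ k) :* (y :+ k)
           := x :* x :+ y :* y :+ (h :* x :+ h :* x :+ (k :* y :+ k :* y)) :+ (h :* h :+ k :* k))
           refl x y h k ⟩
    x * x + y * y + (h * x + h * x + (k * y + k * y)) + (h * h + k * k)
      ≤⟨ +-mono-≤ (+-mono-≤ x²+y²≤N² (+-mono-≤ (+-mono-≤ hx hx) (+-mono-≤ ky ky)))
           (x≤x+y (+-nonneg (*-nonneg 0≤h 0≤k) (*-nonneg 0≤h 0≤k))) ⟩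
    N * N + (h * N + h * N + (k * N + k * N)) + (h * h + k * k + (h * k + h * k))
      ≈⟨ solve 3 (λ N h k →
           N :* N :+ (h :* N :+ h :* N :+ (k :* N :+ k :* N)) :+ (h :* h :+ k :* k :+ (h :* k :+ h :* k))
           := (N :+ (h :+ k)) :* (N :+ (h :+ k))) refl N h k ⟩
    (N + (h + k)) * (N + (h + k)) ∎
    where
    x≤N : x ≤ N
    x≤N = square-cancel-≤ 0≤N (≤-trans (x≤x+y (square-nonneg y)) x²+y²≤N²)
    y≤N : y ≤ N
    y≤N = square-cancel-≤ 0≤N (≤-trans (y≤x+y (square-nonneg x)) x²+y²≤N²)
    hx = *-monoˡ-≤ 0≤h x≤N
    ky = *-monoˡ-≤ 0≤k y≤N

  -- With f² = μ² - e², the square N² = μ² + 2θ + y² lies between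
  -- (y - f)² + e² and (y + f)² + e².
  module _ {N μ θ y f e} (0≤y : 0# ≤ y) (0≤f : 0# ≤ f)
           (N²≈ : N * N ≈ μ * μ + (θ + θ) + y * y)
           (f²+e²≈μ² : f * f + e * e ≈ μ * μ)
           (θ²≤ : θ * θ ≤ (f * f) * (y * y)) where

    private
      0≤fy : 0# ≤ f * y
      0≤fy = *-nonneg 0≤f 0≤y
      -- Taking roots, with both signs of `θ`, places `θ` between `- (f * y)` and `f * y`.
      θ²≤[fy]² : θ * θ ≤ f * y * (f * y)
      θ²≤[fy]² = ≤-respʳ
        (solve 2 (λ f y → f :* f :* (y :* y) := f :* y :* (f :* y)) refl f y) θ²≤
      θ≤fy : θ ≤ f * y
      θ≤fy = square-cancel-≤ 0≤fy θ²≤[fy]²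
      0≤θ+fy : 0# ≤ θ + f * y
      0≤θ+fy = -x≤y⇒0≤x+y (square-cancel-≤ 0≤fy (≤-respˡ (sym (-x*-x≈x*x θ)) θ²≤[fy]²))

    square≤outer : N * N ≤ (y + f) * (y + f) + e * e
    square≤outer = begin
      N * N
        ≈⟨ N²≈ ⟩
      μ * μ + (θ + θ) + y * y
        ≤⟨ +-monoˡ-≤ _ (+-monoʳ-≤ _ (+-mono-≤ θ≤fy θ≤fy)) ⟩
      μ * μ + (f * y + f * y) + y * y
        ≈⟨ +-congʳ (+-congʳ f²+e²≈μ²) ⟨
      f * f + e * e + (f * y + f * y) + y * y
        ≈⟨ solve 3 (λ f e y → f :* f :+ e :* e :+ (f :* y :+ f :* y) :+ y :* y
             := (y :+ f) :* (y :+ f) :+ e :* e) refl f e y ⟩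
      (y + f) * (y + f) + e * e ∎

    -- The witness `u` is the absolute value of `y - f`, obtained by comparing `f` with `y`.
    inner≤square : ∃[ u ] 0# ≤ u × y ≤ u + f × u * u + e * e ≤ N * N
    inner≤square = inner (∣y-f∣ (total f y))
      where
      ∣y-f∣ : f ≤ y ⊎ y ≤ f → ∃[ u ] 0# ≤ u × y ≤ u + f × u * u + (f * y + f * y) ≈ y * y + f * f
      ∣y-f∣ (inj₁ f≤y) with ≤⇒∃+ f≤y
      ... | u , 0≤u , y≈f+u = u , 0≤u , ≤-reflexive (trans y≈f+u (+-comm f u)) , (begin-equality
        u * u + (f * y + f * y)
          ≈⟨ +-congˡ (+-cong (*-congˡ y≈f+u) (*-congˡ y≈f+u)) ⟩
        u * u + (f * (f + u) + f * (f + u))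
          ≈⟨ solve 2 (λ u f → u :* u :+ (f :* (f :+ u) :+ f :* (f :+ u))
               := (f :+ u) :* (f :+ u) :+ f :* f) refl u f ⟩
        (f + u) * (f + u) + f * f
          ≈⟨ +-congʳ (*-cong y≈f+u y≈f+u) ⟨
        y * y + f * f ∎)
      ∣y-f∣ (inj₂ y≤f) with ≤⇒∃+ y≤f
      ... | u , 0≤u , f≈y+u = u , 0≤u , ≤-trans y≤f (y≤x+y 0≤u) , (begin-equality
        u * u + (f * y + f * y)
          ≈⟨ +-congˡ (+-cong (*-congʳ f≈y+u) (*-congʳ f≈y+u)) ⟩
        u * u + ((y + u) * y + (y + u) * y)
          ≈⟨ solve 2 (λ u y → u :* u :+ ((y :+ u) :* y :+ (y :+ u) :* y)
               := y :* y :+ (y :+ u) :* (y :+ u)) refl u y ⟩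
        y * y + (y + u) * (y + u)
          ≈⟨ +-congˡ (*-cong f≈y+u f≈y+u) ⟨
        y * y + f * f ∎)

      inner : ∃[ u ] 0# ≤ u × y ≤ u + f × u * u + (f * y + f * y) ≈ y * y + f * f →
              ∃[ u ] 0# ≤ u × y ≤ u + f × u * u + e * e ≤ N * N
      -- Adding `2 f y` to both sides turns `u²` into `y² + f²` and leaves twice the nonnegative
      -- quantity `θ + f * y` as the gap.
      inner (u , 0≤u , y≤u+f , u²≈) = u , 0≤u , y≤u+f , +-cancelʳ-≤ (f * y + f * y) (begin
        u * u + e * e + (f * y + f * y)
          ≈⟨ solve 3 (λ u² e² w → u² :+ e² :+ w := u² :+ w :+ e²)
               refl (u * u) (e * e) (f * y + f * y) ⟩
        u * u + (f * y + f * y) + e * e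
          ≈⟨ +-congʳ u²≈ ⟩
        y * y + f * f + e * e
          ≈⟨ +-identityʳ _ ⟨
        y * y + f * f + e * e + 0#
          ≤⟨ +-monoʳ-≤ _ (+-nonneg 0≤θ+fy 0≤θ+fy) ⟩
        y * y + f * f + e * e + (θ + f * y + (θ + f * y))
          ≈⟨ solve 5 (λ y² f² e² θ p → y² :+ f² :+ e² :+ (θ :+ p :+ (θ :+ p))
               := f² :+ e² :+ (θ :+ θ) :+ y² :+ (p :+ p))
               refl (y * y) (f * f) (e * e) θ (f * y) ⟩
        f * f + e * e + (θ + θ) + y * y + (f * y + f * y)
          ≈⟨ +-congʳ (+-congʳ (+-congʳ f²+e²≈μ²)) ⟩
        μ * μ + (θ + θ) + y * y + (f * y + f * y)
          ≈⟨ +-congʳ N²≈ ⟨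
        N * N + (f * y + f * y) ∎)

  -- By AM-GM, ε f ≤ √(ε² (w + c d) · 4 d) ≤ w + 2 ε² d.
  module _ {ε c d e w μ f} (0≤ε : 0# ≤ ε) (ε≤1 : ε ≤ 1#) (0≤c : 0# ≤ c) (c≤ε² : c ≤ ε * ε)
           (0≤e : 0# ≤ e) (0≤w : 0# ≤ w) (d≈e+w : d ≈ e + w)
           (0≤μ : 0# ≤ μ) (μ≤ : μ ≤ (1# + c) * d) (f²+e²≈μ² : f * f + e * e ≈ μ * μ) where

    private
      η = ε * ε
      0≤η : 0# ≤ η
      0≤η = square-nonneg ε
      0≤d : 0# ≤ d
      0≤d = ≤-respʳ (sym d≈e+w) (+-nonneg 0≤e 0≤w)
      η≤1 : η ≤ 1#
      η≤1 = ≤-respʳ (*-identityˡ 1#) (*-cong-≤ 0≤ε ε≤1)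
      cd≤d : c * d ≤ d
      cd≤d = ≤-respʳ (*-identityˡ d) (*-monoʳ-≤ 0≤d (≤-trans c≤ε² η≤1))
      cd≤ηd : c * d ≤ η * d
      cd≤ηd = *-monoʳ-≤ 0≤d c≤ε²
      0≤cd : 0# ≤ c * d
      0≤cd = *-nonneg 0≤c 0≤d

      [1+c]d≈ : (1# + c) * d ≈ e + (w + c * d)
      [1+c]d≈ = begin-equality
        (1# + c) * d    ≈⟨ distribʳ d 1# c ⟩
        1# * d + c * d  ≈⟨ +-congʳ (trans (*-identityˡ d) d≈e+w) ⟩
        e + w + c * d   ≈⟨ +-assoc e w (c * d) ⟩
        e + (w + c * d) ∎

      -- The difference of squares `(e + w + c d)² - e²` factors as `(w + c d) (2 e + w + c d)`; the
      -- second factor is at most `4 d` because `e + w` is `d`, `e ≤ d` and `c d ≤ d`.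
      f²≤ : f * f ≤ (w + η * d) * (d + d + (d + d))
      f²≤ = +-cancelʳ-≤ (e * e) (begin
        f * f + e * e
          ≈⟨ f²+e²≈μ² ⟩
        μ * μ
          ≤⟨ *-cong-≤ 0≤μ (≤-respʳ [1+c]d≈ μ≤) ⟩
        (e + (w + c * d)) * (e + (w + c * d))
          ≈⟨ solve 3 (λ e w p → (e :+ (w :+ p)) :* (e :+ (w :+ p))
               := (w :+ p) :* (e :+ w :+ (e :+ p)) :+ e :* e) refl e w (c * d) ⟩
        (w + c * d) * (e + w + (e + c * d)) + e * e
          ≤⟨ +-monoˡ-≤ _ (*-mono-≤ (+-nonneg 0≤w 0≤cd)
               (+-nonneg (+-nonneg 0≤d 0≤d) (+-nonneg 0≤d 0≤d))
               (+-monoʳ-≤ w cd≤ηd)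
               (+-mono-≤ (≤-respˡ d≈e+w (x≤x+y 0≤d)) (+-mono-≤ e≤d cd≤d))) ⟩
        (w + η * d) * (d + d + (d + d)) + e * e ∎)
        where
        e≤d : e ≤ d
        e≤d = ≤-respʳ (sym d≈e+w) (x≤x+y 0≤w)

      εf≤ : ε * f ≤ w + (η * d + η * d)
      εf≤ = square-cancel-≤ (+-nonneg 0≤w (+-nonneg (*-nonneg 0≤η 0≤d) (*-nonneg 0≤η 0≤d))) (begin
        ε * f * (ε * f)
          ≈⟨ solve 2 (λ ε f → ε :* f :* (ε :* f) := ε :* ε :* (f :* f)) refl ε f ⟩
        η * (f * f)
          ≤⟨ *-monoˡ-≤ 0≤η f²≤ ⟩
        η * ((w + η * d) * (d + d + (d + d)))
          -- The difference `(w + 2 η d)² - 4 η d (w + η d)` is exactly `w * w`.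
          ≤⟨ y≤x+y (square-nonneg w) ⟩
        w * w + η * ((w + η * d) * (d + d + (d + d)))
          ≈⟨ solve 3 (λ w η d →
               w :* w :+ η :* ((w :+ η :* d) :* (d :+ d :+ (d :+ d)))
               := (w :+ (η :* d :+ η :* d)) :* (w :+ (η :* d :+ η :* d))) refl w η d ⟩
        (w + (η * d + η * d)) * (w + (η * d + η * d)) ∎)

    -- The factor `ε` trades the square root `f` for terms linear in `w` and `d`, which can be
    -- summed over the rows. The other terms lose their factor through `ε ≤ 1`.
    error-bound : ε * (f + (w + c * d)) ≤ w + w + (η * d + η * d + η * d)
    error-bound = begin
      ε * (f + (w + c * d))
        ≈⟨ distribˡ ε f _ ⟩
      ε * f + ε * (w + c * d)
        ≤⟨ +-mono-≤ εf≤ (*-monoʳ-≤ (+-nonneg 0≤w 0≤cd) ε≤1) ⟩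
      w + (η * d + η * d) + 1# * (w + c * d)
        ≤⟨ +-monoʳ-≤ _ (*-monoˡ-≤ 0≤1 (+-monoʳ-≤ w cd≤ηd)) ⟩
      w + (η * d + η * d) + 1# * (w + η * d)
        ≈⟨ solve 2 (λ w p → w :+ (p :+ p) :+ con 1 :* (w :+ p)
             := w :+ w :+ (p :+ p :+ p)) refl w (η * d) ⟩
      w + w + (η * d + η * d + η * d) ∎

-- Norms, inner products and membership in a subspace.

module Geometry (R : Reals) where
  open EuclideanSpace R
  open OrderedField R
  open ≤-Reasoning
  open AbelianGroupProperties +-abelianGroup using (⁻¹-anti-homo‿-)
  open CommutativeMonoidSum +-commutativeMonoid using (sum-cong-≋)
  open RingProperties ring using (-‿distribˡ-*; -‿distribʳ-*)
  open NatSolver commutativeSemiring using (solve; _:=_; _:+_; _:*_; con)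

  hypotenuse : ℝ → ℝ → ℝ
  hypotenuse x y = √ (x * x + y * y)

  hypotenuse-square : ∀ x y → hypotenuse x y * hypotenuse x y ≈ x * x + y * y
  hypotenuse-square x y = √-square (+-nonneg (square-nonneg x) (square-nonneg y))

  ‖x‖²≈⟪x,x⟫ : ∀ {d} (x : Point d) → ‖ x ‖ * ‖ x ‖ ≈ ⟪ x , x ⟫
  ‖x‖²≈⟪x,x⟫ x = √-square (sum-nonneg _ λ i → square-nonneg (x i))

  -- Taking any `x` pointwise equal to `m + t v` lets it apply to points written as differences,
  -- such as `a -ᵛ s`.
  ⟪⟫-expand : ∀ {d} t (x m v : Point d) → x ≋ m +ᵛ t *ᵛ v →
              ⟪ x , x ⟫ ≈ ⟪ m , m ⟫ + (t * ⟪ m , v ⟫ + t * ⟪ m , v ⟫) + t * t * ⟪ v , v ⟫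
  ⟪⟫-expand {zero}  t x m v x≋ =
    solve 1 (λ t → con 0 := con 0 :+ (t :* con 0 :+ t :* con 0) :+ t :* t :* con 0) refl t
  ⟪⟫-expand {suc d} t x m v x≋ = begin-equality
    x zero * x zero + ⟪ x ∘ suc , x ∘ suc ⟫
      ≈⟨ +-cong (*-cong (x≋ zero) (x≋ zero)) (⟪⟫-expand t (x ∘ suc) (m ∘ suc) (v ∘ suc) (x≋ ∘ suc)) ⟩
    (m zero + t * v zero) * (m zero + t * v zero) + (mm + (t * mv + t * mv) + t * t * vv)
      ≈⟨ solve 6 (λ t a b mm mv vv →
           (a :+ t :* b) :* (a :+ t :* b) :+ (mm :+ (t :* mv :+ t :* mv) :+ t :* t :* vv)
           := a :* a :+ mm :+ (t :* (a :* b :+ mv) :+ t :* (a :* b :+ mv)) :+ t :* t :* (b :* b :+ vv))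
           refl t (m zero) (v zero) mm mv vv ⟩
    m zero * m zero + mm + (t * (m zero * v zero + mv) + t * (m zero * v zero + mv))
      + t * t * (v zero * v zero + vv) ∎
    where
    mm = ⟪ m ∘ suc , m ∘ suc ⟫
    mv = ⟪ m ∘ suc , v ∘ suc ⟫
    vv = ⟪ v ∘ suc , v ∘ suc ⟫

  combination∈ : ∀ {m d} (P : Subspace d) (c : Vector ℝ m) (v : Vector (Point d) m) →
                 (∀ i → v i ∈ Subspace.points P) → combination c v ∈ Subspace.points P
  combination∈ {zero}  P c v v∈P = Subspace.0∈ P
  combination∈ {suc m} P c v v∈P = Subspace.+∈ P (Subspace.*∈ P (c zero) (v∈P zero))
    (combination∈ P (c ∘ suc) (v ∘ suc) (v∈P ∘ suc))

  ·∈ : ∀ {d r} (P : Subspace d) (B : Matrix d r) (x : Point r) →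
       (∀ j → transpose B j ∈ Subspace.points P) → B · x ∈ Subspace.points P
  ·∈ P B x B∈P = Subspace.resp P
    (λ i → sum-cong-≋ λ j → *-comm (x j) (B i j))
    (combination∈ P x (transpose B) B∈P)

  ‖‖-nonneg : ∀ {d} (x : Point d) → 0# ≤ ‖ x ‖
  ‖‖-nonneg x = √-nonneg ⟪ x , x ⟫

  hypotenuse-nonneg : ∀ x y → 0# ≤ hypotenuse x y
  hypotenuse-nonneg x y = √-nonneg (x * x + y * y)

  -- Distance to a set as an infimum.

  dist≤ : ∀ {d} (x : Point d) S {s} → s ∈ NonemptySet.points S → dist x S ≤ ‖ x -ᵛ s ‖
  dist≤ x S s∈S = proj₁ (proj₂ (dist-exists x S)) (_ , s∈S , refl)

  ≤dist : ∀ {d} (x : Point d) S {l} →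
          (∀ {s} → s ∈ NonemptySet.points S → l ≤ ‖ x -ᵛ s ‖) → l ≤ dist x S
  ≤dist x S l≤ = proj₂ (proj₂ (dist-exists x S)) λ { (s , s∈S , t≈) → ≤-respʳ (sym t≈) (l≤ s∈S) }

  dist-antitone : ∀ {d} (x : Point d) S S′ → NonemptySet.points S ⊆ NonemptySet.points S′ →
                  dist x S′ ≤ dist x S
  dist-antitone x S S′ S⊆S′ = ≤dist x S λ s∈S → dist≤ x S′ (S⊆S′ s∈S)

  -- The infimum need not be attained, so the bound is first solved for the distance: if `y ≤ x`,
  -- then `K = √ (x * x - y * y)` is below every `‖ b -ᵛ s ‖`, hence below `dist b S`. The case
  -- `x ≤ y`, which includes all negative `x`, follows from `y` alone.
  ≤hypotenuse-dist : ∀ {d} (b : Point d) S {x y} → 0# ≤ y →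
                     (∀ {s} → s ∈ NonemptySet.points S → x ≤ hypotenuse ‖ b -ᵛ s ‖ y) →
                     x ≤ hypotenuse (dist b S) y
  ≤hypotenuse-dist b S {x} {y} 0≤y x≤ with total x y
  ... | inj₁ x≤y = ≤-trans x≤y (√-upper (+-nonneg (square-nonneg _) (square-nonneg y)) 0≤y
                     (y≤x+y (square-nonneg _)))
  ... | inj₂ y≤x = √-upper (+-nonneg (square-nonneg _) (square-nonneg y)) 0≤x (begin
    x * x                         ≈⟨ x-y+y≈x (x * x) (y * y) ⟨
    x * x - y * y + y * y         ≈⟨ +-congʳ (√-square 0≤x²-y²) ⟨
    K * K + y * y                 ≤⟨ +-monoˡ-≤ _ (*-cong-≤ (√-nonneg _) (≤dist b S K≤)) ⟩
    dist b S * dist b S + y * y   ∎)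
    where
    0≤x : 0# ≤ x
    0≤x = ≤-trans 0≤y y≤x
    0≤x²-y² : 0# ≤ x * x - y * y
    0≤x²-y² = x≤y⇒0≤y-x (*-cong-≤ 0≤y y≤x)
    K = √ (x * x - y * y)
    K≤ : ∀ {s} → s ∈ NonemptySet.points S → K ≤ ‖ b -ᵛ s ‖
    K≤ {s} s∈S = square-cancel-≤ (√-nonneg _) (begin
      K * K                     ≈⟨ √-square 0≤x²-y² ⟩
      x * x - y * y             ≤⟨ x≤y+z⇒x-z≤y (≤-respʳ (hypotenuse-square ‖ b -ᵛ s ‖ y)
                                     (*-cong-≤ 0≤x (x≤ s∈S))) ⟩
      ‖ b -ᵛ s ‖ * ‖ b -ᵛ s ‖   ∎)

  -- The sum of two subspaces and the line through `b` and `s`.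

  module _ {d} (P W : Subspace d) where

    ⊞-⊆ˡ : Subspace.points P ⊆ NonemptySet.points (P ⊞ W)
    ⊞-⊆ˡ {x} x∈P = 1 , (λ _ → 1#) , (λ _ → x) , (λ _ → inj₁ x∈P)
      , λ j → sym (trans (+-identityʳ _) (*-identityˡ (x j)))

    ⊞-⊆ʳ : Subspace.points W ⊆ NonemptySet.points (P ⊞ W)
    ⊞-⊆ʳ {x} x∈W = 1 , (λ _ → 1#) , (λ _ → x) , (λ _ → inj₂ x∈W)
      , λ j → sym (trans (+-identityʳ _) (*-identityˡ (x j)))

    -- The point is the combination `(1 - t) b + t s` of a point of `P` and a point of `W`.
    ⊞-line : ∀ {b s} t → b ∈ Subspace.points P → s ∈ Subspace.points W →
             b -ᵛ t *ᵛ (b -ᵛ s) ∈ NonemptySet.points (P ⊞ W)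
    ⊞-line {b} {s} t b∈P s∈W = 2 , c , v , v∈ , λ j → begin-equality
      b j - t * (b j - s j)
        ≈⟨ +-congˡ (trans (-‿distribʳ-* t _) (*-congˡ (⁻¹-anti-homo‿- (b j) (s j)))) ⟩
      b j + t * (s j - b j)
        ≈⟨ solve 4 (λ b t s n → b :+ t :* (s :+ n) := b :+ t :* n :+ t :* s) refl (b j) t (s j) (- b j) ⟩
      b j + t * - b j + t * s j
        ≈⟨ +-congʳ (+-congˡ (trans (sym (-‿distribʳ-* t (b j))) (-‿distribˡ-* t (b j)))) ⟩
      b j + - t * b j + t * s j
        ≈⟨ solve 4 (λ b t s n → b :+ n :* b :+ t :* s := (con 1 :+ n) :* b :+ (t :* s :+ con 0))
             refl (b j) t (s j) (- t) ⟩
      (1# + - t) * b j + (t * s j + 0#) ∎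
      where
      c : Vector ℝ 2
      c zero       = 1# - t
      c (suc zero) = t
      v : Vector (Point d) 2
      v zero       = b
      v (suc zero) = s
      v∈ : ∀ i → v i ∈ Subspace.points P ∪ Subspace.points W
      v∈ zero       = inj₁ b∈P
      v∈ (suc zero) = inj₂ s∈W

    module _ (a : Point d) {b s f} (b∈P : b ∈ Subspace.points P) (s∈W : s ∈ Subspace.points W)
             (0≤f : 0# ≤ f)
             (f²+e²≈ : f * f + dist a (P ⊞ W) * dist a (P ⊞ W) ≈ ‖ a -ᵛ b ‖ * ‖ a -ᵛ b ‖) where

      private
        m = a -ᵛ b
        v = b -ᵛ s
        e = dist a (P ⊞ W)
        θ = ⟪ m , v ⟫

      -- The line through `b` and `s` lies in `P ⊞ W`, so its points are at distance at least `e`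
      -- from `a`. Thus `‖ m + t v ‖² - e²`, whose constant term is `f²`, is nonnegative for every
      -- `t`.
      cross-term-bound : θ * θ ≤ (f * f) * (‖ v ‖ * ‖ v ‖)
      cross-term-bound = discriminant (square-nonneg f) (square-nonneg ‖ v ‖) λ t →
        +-cancelʳ-≤ (e * e) (begin
          0# + e * e
            ≈⟨ +-identityˡ _ ⟩
          e * e
            ≤⟨ *-cong-≤ (dist-nonneg a (P ⊞ W)) (dist≤ a (P ⊞ W) (⊞-line t b∈P s∈W)) ⟩
          ‖ a -ᵛ (b -ᵛ t *ᵛ v) ‖ * ‖ a -ᵛ (b -ᵛ t *ᵛ v) ‖
            ≈⟨ ‖x‖²≈⟪x,x⟫ (a -ᵛ (b -ᵛ t *ᵛ v)) ⟩
          ⟪ a -ᵛ (b -ᵛ t *ᵛ v) , a -ᵛ (b -ᵛ t *ᵛ v) ⟫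
            ≈⟨ ⟪⟫-expand t _ m v (λ j → trans
                 (+-congˡ (trans (⁻¹-anti-homo‿- (b j) (t * v j)) (+-comm _ (- b j))))
                 (sym (+-assoc (a j) (- b j) (t * v j)))) ⟩
          ⟪ m , m ⟫ + (t * θ + t * θ) + t * t * ⟪ v , v ⟫
            ≈⟨ +-cong (+-congʳ (trans f²+e²≈ (‖x‖²≈⟪x,x⟫ m))) (*-congˡ (‖x‖²≈⟪x,x⟫ v)) ⟨
          f * f + e * e + (t * θ + t * θ) + t * t * (‖ v ‖ * ‖ v ‖)
            ≈⟨ solve 4 (λ f² e² p q → f² :+ e² :+ p :+ q := f² :+ p :+ q :+ e²)
                 refl (f * f) (e * e) (t * θ + t * θ) (t * t * (‖ v ‖ * ‖ v ‖)) ⟩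
          f * f + (t * θ + t * θ) + t * t * (‖ v ‖ * ‖ v ‖) + e * e ∎)

      distance-square : ‖ a -ᵛ s ‖ * ‖ a -ᵛ s ‖ ≈ ‖ m ‖ * ‖ m ‖ + (θ + θ) + ‖ v ‖ * ‖ v ‖
      distance-square = begin-equality
        ‖ a -ᵛ s ‖ * ‖ a -ᵛ s ‖
          ≈⟨ ‖x‖²≈⟪x,x⟫ (a -ᵛ s) ⟩
        ⟪ a -ᵛ s , a -ᵛ s ⟫
          ≈⟨ ⟪⟫-expand 1# _ m v (λ j → begin-equality
               a j - s j
                 ≈⟨ +-congʳ (x-y+y≈x (a j) (b j)) ⟨
               a j - b j + b j - s j
                 ≈⟨ trans (+-assoc _ (b j) (- s j)) (+-congˡ (sym (*-identityˡ _))) ⟩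
               a j - b j + 1# * (b j - s j) ∎) ⟩
        ⟪ m , m ⟫ + (1# * θ + 1# * θ) + 1# * 1# * ⟪ v , v ⟫
          ≈⟨ solve 3 (λ mm θ vv → mm :+ (con 1 :* θ :+ con 1 :* θ) :+ con 1 :* con 1 :* vv
               := mm :+ (θ :+ θ) :+ vv) refl ⟪ m , m ⟫ θ ⟪ v , v ⟫ ⟩
        ⟪ m , m ⟫ + (θ + θ) + ⟪ v , v ⟫
          ≈⟨ +-cong (+-congʳ (‖x‖²≈⟪x,x⟫ m)) (‖x‖²≈⟪x,x⟫ v) ⟨
        ‖ m ‖ * ‖ m ‖ + (θ + θ) + ‖ v ‖ * ‖ v ‖ ∎

      ‖a-s‖²≤outer : ‖ a -ᵛ s ‖ * ‖ a -ᵛ s ‖ ≤ (‖ v ‖ + f) * (‖ v ‖ + f) + e * e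
      ‖a-s‖²≤outer = square≤outer {‖ a -ᵛ s ‖} {‖ m ‖} {θ} {‖ v ‖} {f} {e}
        (‖‖-nonneg v) 0≤f distance-square f²+e²≈ cross-term-bound

      inner≤‖a-s‖² : ∃[ u ] 0# ≤ u × ‖ v ‖ ≤ u + f × u * u + e * e ≤ ‖ a -ᵛ s ‖ * ‖ a -ᵛ s ‖
      inner≤‖a-s‖² = inner≤square {‖ a -ᵛ s ‖} {‖ m ‖} {θ} {‖ v ‖} {f} {e}
        (‖‖-nonneg v) 0≤f distance-square f²+e²≈ cross-term-bound

  -- Comparison of the two costs for a single row.

  module Pointwise
    {d} (P V : Subspace d) (S : NonemptySet d) (S⊆V : LiesIn S V)
    (a b : Point d) (b∈P : b ∈ Subspace.points P) {ε c apx}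
    (0≤ε : 0# ≤ ε) (ε≤1 : ε ≤ 1#) (0≤c : 0# ≤ c) (c≤ε² : c ≤ ε * ε)
    (∥a-b∥≤ : ‖ a -ᵛ b ‖ ≤ (1# + c) * dist a ⌊ P ⌋)
    (≤apx : (1# - c) * dist a ⌊ P ⌋ ≤ apx) (apx≤ : apx ≤ (1# + c) * dist a ⌊ P ⌋)
    where

    -- `w` is the gain for this row from enlarging `P` to `P ⊞ V`; `error` will bound `ε` times the
    -- deviation between `Z` and `L`.
    D e w L Z error : ℝ
    D = dist a ⌊ P ⌋
    e = dist a (P ⊞ V)
    w = D - e
    L = dist a S
    Z = hypotenuse (dist b S) apx
    error = w + w + (ε * ε * D + ε * ε * D + ε * ε * D)

    0≤w : 0# ≤ w
    0≤w = x≤y⇒0≤y-x (dist-antitone a ⌊ P ⌋ (P ⊞ V) (⊞-⊆ˡ P V))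

    private
      μ = ‖ a -ᵛ b ‖
      η = ε * ε

      0≤D : 0# ≤ D
      0≤D = dist-nonneg a ⌊ P ⌋
      0≤e : 0# ≤ e
      0≤e = dist-nonneg a (P ⊞ V)
      e≤D : e ≤ D
      e≤D = dist-antitone a ⌊ P ⌋ (P ⊞ V) (⊞-⊆ˡ P V)
      D≈e+w : D ≈ e + w
      D≈e+w = trans (sym (x-y+y≈x D e)) (+-comm w e)
      0≤w+cD : 0# ≤ w + c * D
      0≤w+cD = +-nonneg 0≤w (*-nonneg 0≤c 0≤D)

      η≤1 : η ≤ 1#
      η≤1 = ≤-respʳ (*-identityˡ 1#) (*-cong-≤ 0≤ε ε≤1)
      0≤apx : 0# ≤ apx
      0≤apx = ≤-trans (*-nonneg (x≤y⇒0≤y-x (≤-trans c≤ε² η≤1)) 0≤D) ≤apx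
      apx≤e+ : apx ≤ e + (w + c * D)
      apx≤e+ = begin
        apx             ≤⟨ apx≤ ⟩
        (1# + c) * D    ≈⟨ distribʳ D 1# c ⟩
        1# * D + c * D  ≈⟨ +-congʳ (trans (*-identityˡ D) D≈e+w) ⟩
        e + w + c * D   ≈⟨ +-assoc e w (c * D) ⟩
        e + (w + c * D) ∎
      e≤apx+ : e ≤ apx + (w + c * D)
      e≤apx+ = begin
        e                      ≤⟨ e≤D ⟩
        D                      ≈⟨ *-identityˡ D ⟨
        1# * D                 ≈⟨ *-congʳ (x-y+y≈x 1# c) ⟨
        (1# - c + c) * D       ≈⟨ distribʳ D _ c ⟩
        -- The added `w` is slack that gives both directions the same error `w + c * D`.
        (1# - c) * D + c * D   ≤⟨ +-mono-≤ ≤apx (y≤x+y 0≤w) ⟩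
        apx + (w + c * D)      ∎

      -- Since `b` lies in `P`, hence in `P ⊞ V`, `e ≤ μ`; so the root `f` below is a genuine one
      -- and not the default `0#`.
      0≤μ²-e² : 0# ≤ μ * μ - e * e
      0≤μ²-e² = x≤y⇒0≤y-x (*-cong-≤ 0≤e (dist≤ a (P ⊞ V) (⊞-⊆ˡ P V b∈P)))
      f = √ (μ * μ - e * e)
      0≤f : 0# ≤ f
      0≤f = √-nonneg (μ * μ - e * e)
      f²+e²≈μ² : f * f + e * e ≈ μ * μ
      f²+e²≈μ² = trans (+-congʳ (√-square 0≤μ²-e²)) (x-y+y≈x (μ * μ) (e * e))

      δ = f + (w + c * D)
      0≤δ : 0# ≤ δ
      0≤δ = +-nonneg 0≤f 0≤w+cD
      εδ≤error : ε * δ ≤ error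
      εδ≤error = error-bound 0≤ε ε≤1 0≤c c≤ε² 0≤e 0≤w D≈e+w (‖‖-nonneg (a -ᵛ b)) ∥a-b∥≤ f²+e²≈μ²

      -- The pair `(u , e)` has length at most `‖ a -ᵛ s ‖`; shifting it by `(f , w + c * D)`
      -- dominates `(dist b S , apx)` in each coordinate.
      Z≤‖a-s‖+δ : ∀ {s} → s ∈ NonemptySet.points S → Z ≤ ‖ a -ᵛ s ‖ + δ
      Z≤‖a-s‖+δ {s} s∈S = from-inner (inner≤‖a-s‖² P V a b∈P (S⊆V s∈S) 0≤f f²+e²≈μ²)
        where
        from-inner : ∃[ u ] 0# ≤ u × ‖ b -ᵛ s ‖ ≤ u + f × u * u + e * e ≤ ‖ a -ᵛ s ‖ * ‖ a -ᵛ s ‖ →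
                     Z ≤ ‖ a -ᵛ s ‖ + δ
        from-inner (u , 0≤u , y≤u+f , u²+e²≤N²) =
          square-cancel-≤ (+-nonneg (‖‖-nonneg (a -ᵛ s)) 0≤δ) (begin
            Z * Z
              ≈⟨ hypotenuse-square (dist b S) apx ⟩
            dist b S * dist b S + apx * apx
              ≤⟨ +-mono-≤ (*-cong-≤ (dist-nonneg b S) (≤-trans (dist≤ b S s∈S) y≤u+f))
                   (*-cong-≤ 0≤apx apx≤e+) ⟩
            (u + f) * (u + f) + (e + (w + c * D)) * (e + (w + c * D))
              ≤⟨ hypotenuse-mono {N = ‖ a -ᵛ s ‖} 0≤u 0≤e (‖‖-nonneg (a -ᵛ s)) 0≤f 0≤w+cD u²+e²≤N² ⟩
            (‖ a -ᵛ s ‖ + δ) * (‖ a -ᵛ s ‖ + δ) ∎)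

      -- Conversely, `(‖ b -ᵛ s ‖ , apx)` shifted by `(f , w + c * D)` dominates
      -- `(‖ b -ᵛ s ‖ + f , e)`, whose length is at least `‖ a -ᵛ s ‖`.
      L-δ≤hypotenuse : ∀ {s} → s ∈ NonemptySet.points S → L - δ ≤ hypotenuse ‖ b -ᵛ s ‖ apx
      L-δ≤hypotenuse {s} s∈S = x≤y+z⇒x-z≤y (≤-trans (dist≤ a S s∈S)
        (square-cancel-≤ (+-nonneg (hypotenuse-nonneg y apx) 0≤δ) (begin
          ‖ a -ᵛ s ‖ * ‖ a -ᵛ s ‖
            ≤⟨ ‖a-s‖²≤outer P V a b∈P (S⊆V s∈S) 0≤f f²+e²≈μ² ⟩
          (y + f) * (y + f) + e * e
            ≤⟨ +-monoʳ-≤ _ (*-cong-≤ 0≤e e≤apx+) ⟩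
          (y + f) * (y + f) + (apx + (w + c * D)) * (apx + (w + c * D))
            ≤⟨ hypotenuse-mono {y} {apx} {hypotenuse y apx} (‖‖-nonneg (b -ᵛ s)) 0≤apx
                 (hypotenuse-nonneg y apx) 0≤f 0≤w+cD (≤-reflexive (sym (hypotenuse-square y apx))) ⟩
          (hypotenuse y apx + δ) * (hypotenuse y apx + δ) ∎)))
        where y = ‖ b -ᵛ s ‖

      scale : ∀ {x y} → x ≤ y + δ → ε * x ≤ ε * y + error
      scale {x} {y} x≤y+δ = begin
        ε * x           ≤⟨ *-monoˡ-≤ 0≤ε x≤y+δ ⟩
        ε * (y + δ)     ≈⟨ distribˡ ε y δ ⟩
        ε * y + ε * δ   ≤⟨ +-monoʳ-≤ _ εδ≤error ⟩
        ε * y + error   ∎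

    εZ≤εL+error : ε * Z ≤ ε * L + error
    εZ≤εL+error = scale (x-z≤y⇒x≤y+z (≤dist a S λ s∈S → x≤y+z⇒x-z≤y (Z≤‖a-s‖+δ s∈S)))

    εL≤εZ+error : ε * L ≤ ε * Z + error
    εL≤εZ+error = scale (x-z≤y⇒x≤y+z (≤hypotenuse-dist b S 0≤apx L-δ≤hypotenuse))

-- Summation over the rows.

theorem4 : (R : Reals) → let open EuclideanSpace R in
  (n d k r : ℕ) → 1 ℕ.≤ k →
  (ε : ℝ) → 0# < ε → ε < 1# →
  (A : Matrix n d) →
  (P : Subspace d) → HasDimension P r →
  (∀ (W : Subspace d) → HasDimension≤ W k →
    ∑dist A ⌊ P ⌋ - ∑dist A (P ⊞ W) ≤ (ε * ε) / 80 * SubApx k A) →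
  (B : Matrix d r) → IsOrthonormalBasis P B →
  let ε-c = (ε * ε) / 6 in
  (aᴮ : Fin n → Point r) →
  (∀ i → ‖ A i -ᵛ B · aᴮ i ‖ ≤ (1# + ε-c) * dist (A i) ⌊ P ⌋) →
  (apx : Fin n → ℝ) →
  (∀ i → (1# - ε-c) * dist (A i) ⌊ P ⌋ ≤ apx i × apx i ≤ (1# + ε-c) * dist (A i) ⌊ P ⌋) →
  (S : NonemptySet d) → (V : Subspace d) → HasDimension≤ V k → LiesIn S V →
  sum (λ i → √ (dist (B · aᴮ i) S * dist (B · aᴮ i) S + apx i * apx i))
    ≈⟨1± 5 • ε ⟩ ∑dist A S
theorem4 R n d k r _ ε 0<ε ε<1 A P _ improvement≤ B (B-basis , _) aᴮ ‖a-b‖≤ apx apx≈ S V dim-V S⊆V =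
  lower , upper
  where
  open EuclideanSpace R
  open OrderedField R
  open Geometry R
  open ≤-Reasoning
  open CommutativeMonoidSum +-commutativeMonoid using (∑-distrib-+; sum-cong-≋)
  open SemiringSum semiring using (*-distribˡ-sum)
  open SemiringMult semiring using (×-assoc-*)
  open NatSolver commutativeSemiring using (solve; _:=_; _:+_; _:*_; con)

  η = ε * ε
  0≤ε : 0# ≤ ε
  0≤ε = proj₁ 0<ε
  0≤η : 0# ≤ η
  0≤η = square-nonneg ε
  c≤η : η / 6 ≤ η
  -- `1 • x` unfolds to `x + 0#`.
  c≤η = ≤-respˡ (+-identityʳ _) (m•[x/n]≤x 1 6 0≤η (ℕ.s≤s ℕ.z≤n))

  module At (i : Fin n) = Pointwise P V S S⊆V (A i) (B · aᴮ i)
    (·∈ P B (aᴮ i) (proj₁ B-basis)) {ε} {η / 6} {apx i} 0≤ε (proj₁ ε<1)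
    (/-nonneg 6 0≤η) c≤η (‖a-b‖≤ i) (proj₁ (apx≈ i)) (proj₂ (apx≈ i))

  T Z D E W error : ℝ
  T = ∑dist A S
  Z = sum At.Z
  D = ∑dist A ⌊ P ⌋
  E = ∑dist A (P ⊞ V)
  W = sum At.w
  error = sum At.error

  0≤T : 0# ≤ T
  0≤T = sum-nonneg At.L λ i → dist-nonneg (A i) S

  D≈W+E : D ≈ W + E
  D≈W+E = trans (sum-cong-≋ λ i → sym (x-y+y≈x (At.D i) (At.e i))) (∑-distrib-+ At.w At.e)

  -- The hypothesis on `P` is applied to the subspace `V` containing `S`. The same `V` competes in
  -- `SubApx`, and its distances are at most those to `S`.
  W≤ : W ≤ η / 80 * T
  W≤ = begin
    W                    ≤⟨ +-cancelʳ-≤ E (≤-respˡ D≈W+E (x-z≤y⇒x≤y+z (improvement≤ V dim-V))) ⟩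
    η / 80 * SubApx k A  ≤⟨ *-monoˡ-≤ (/-nonneg 80 0≤η) SubApx≤T ⟩
    η / 80 * T           ∎
    where
    SubApx≤T : SubApx k A ≤ T
    SubApx≤T = ≤-trans (proj₁ (proj₂ (SubApx-exists k A)) (V , dim-V , refl))
      (sum-mono-≤ λ i → dist-antitone (A i) S ⌊ V ⌋ S⊆V)

  -- Five copies of `W` occur in the total error: two directly and three from bounding `η * D` by
  -- `W + η * T`.
  5W≤ηT : 5 • W ≤ η * T
  5W≤ηT = begin
    5 • W              ≤⟨ •-monoʳ-≤ 5 W≤ ⟩
    5 • (η / 80 * T)   ≈⟨ ×-assoc-* 5 (η / 80) T ⟨
    5 • (η / 80) * T   ≤⟨ *-monoʳ-≤ 0≤T (m•[x/n]≤x 5 80 0≤η (ℕ.m≤m+n 5 75)) ⟩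
    η * T              ∎

  0≤W : 0# ≤ W
  0≤W = sum-nonneg At.w At.0≤w

  -- `D` is `W + E`, and `E ≤ T` because `S` lies in `V` and so in `P ⊞ V`.
  D≤W+T : D ≤ W + T
  D≤W+T = ≤-respˡ (sym D≈W+E) (+-monoʳ-≤ W (sum-mono-≤ λ i →
    dist-antitone (A i) S (P ⊞ V) λ s∈S → ⊞-⊆ʳ P V (S⊆V s∈S)))

  ∑ηD≈ηD : sum (λ i → η * At.D i) ≈ η * D
  ∑ηD≈ηD = sym (*-distribˡ-sum η At.D)

  error≈ : error ≈ W + W + (η * D + η * D + η * D)
  error≈ = trans (∑-distrib-+ (λ i → At.w i + At.w i) (λ i → η * At.D i + η * At.D i + η * At.D i))
    (+-cong (∑-distrib-+ At.w At.w)
      (trans (∑-distrib-+ (λ i → η * At.D i + η * At.D i) (λ i → η * At.D i))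
        (+-cong (trans (∑-distrib-+ (λ i → η * At.D i) (λ i → η * At.D i)) (+-cong ∑ηD≈ηD ∑ηD≈ηD))
          ∑ηD≈ηD)))

  ηD≤ : η * D ≤ W + η * T
  ηD≤ = begin
    η * D           ≤⟨ *-monoˡ-≤ 0≤η D≤W+T ⟩
    η * (W + T)     ≈⟨ distribˡ η W T ⟩
    η * W + η * T   ≤⟨ +-monoˡ-≤ _ (*-monoʳ-≤ 0≤W η≤1) ⟩
    1# * W + η * T  ≈⟨ +-congʳ (*-identityˡ W) ⟩
    W + η * T       ∎
    where
    η≤1 : η ≤ 1#
    η≤1 = ≤-respʳ (*-identityˡ 1#) (*-cong-≤ 0≤ε (proj₁ ε<1))

  error≤ : error ≤ ε * (5 • ε * T)
  error≤ = begin
    error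
      ≈⟨ error≈ ⟩
    W + W + (η * D + η * D + η * D)
      ≤⟨ +-monoʳ-≤ (W + W) (+-mono-≤ (+-mono-≤ ηD≤ ηD≤) ηD≤) ⟩
    W + W + (W + η * T + (W + η * T) + (W + η * T))
      ≈⟨ solve 2 (λ w x → w :+ w :+ (w :+ x :+ (w :+ x) :+ (w :+ x))
           := w :+ (w :+ (w :+ (w :+ (w :+ con 0)))) :+ (x :+ x :+ x)) refl W (η * T) ⟩
    5 • W + (η * T + η * T + η * T)
      ≤⟨ +-monoˡ-≤ _ 5W≤ηT ⟩
    η * T + (η * T + η * T + η * T)
      -- The estimate so far is `4 η T`; a fifth copy reaches the constant of the theorem, and one
      -- `ε` of `η` is then split off for cancellation.
      ≤⟨ x≤x+y (*-nonneg 0≤η 0≤T) ⟩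
    η * T + (η * T + η * T + η * T) + η * T
      ≈⟨ solve 2 (λ ε t → ε :* ε :* t :+ (ε :* ε :* t :+ ε :* ε :* t :+ ε :* ε :* t) :+ ε :* ε :* t
           := ε :* ((ε :+ (ε :+ (ε :+ (ε :+ (ε :+ con 0))))) :* t)) refl ε T ⟩
    ε * (5 • ε * T) ∎

  -- Here the strict positivity of `ε` removes the factor carried since the pointwise estimates.
  cancel-ε : ∀ {x y} → ε * x ≤ ε * y + error → x ≤ y + 5 • ε * T
  cancel-ε {x} {y} p = *-cancelˡ-≤ 0<ε (begin
    ε * x                       ≤⟨ p ⟩
    ε * y + error               ≤⟨ +-monoʳ-≤ _ error≤ ⟩
    ε * y + ε * (5 • ε * T)     ≈⟨ distribˡ ε y _ ⟨
    ε * (y + 5 • ε * T)         ∎)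

  upper : Z ≤ (1# + 5 • ε) * T
  upper = begin
    Z                    ≤⟨ cancel-ε (ε*sum-mono-≤ ε At.Z At.L At.error At.εZ≤εL+error) ⟩
    T + 5 • ε * T        ≈⟨ +-congʳ (*-identityˡ T) ⟨
    1# * T + 5 • ε * T   ≈⟨ distribʳ T 1# (5 • ε) ⟨
    (1# + 5 • ε) * T     ∎

  lower : (1# - 5 • ε) * T ≤ Z
  lower = +-cancelʳ-≤ (5 • ε * T) (begin
    (1# - 5 • ε) * T + 5 • ε * T   ≈⟨ distribʳ T _ (5 • ε) ⟨
    (1# - 5 • ε + 5 • ε) * T       ≈⟨ *-congʳ (x-y+y≈x 1# (5 • ε)) ⟩
    1# * T                         ≈⟨ *-identityˡ T ⟩
    T                              ≤⟨ cancel-ε (ε*sum-mono-≤ ε At.L At.Z At.error At.εL≤εZ+error) ⟩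
    Z + 5 • ε * T                  ∎)
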